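{- Let $\mu$ be the morphism on $\{0,1\}^*$ with $\mu(0)=01$, $\mu(1)=10$, let $A=\{00,11,010010,101101\}$ and $\mathcal{A}=\bigcup_{k\ge 0}\mu^k(A)$. Then the set of binary words that are squares and are $7/3$-power-free is exactly the set of conjugates of words in $\mathcal{A}$.
   Context: A finite word $w$ is an $\alpha$-power ($\alpha$ rational) if $w = x^n x'$ with $x$ nonempty, $x'$ a prefix of $x$, and $\alpha = n + |x'|/|x|$. A square is a word $xx$ with $x$ nonempty. A word is $\alpha$-power-free if none of its factors (contiguous subwords) is an $\alpha$-power. A conjugate of a word $x$ is any word $y$ such that $x=uv$ and $y=vu$ for some words $u,v$ (possibly empty).
   Formalization: "7/3-power-free" is taken in the standard sense that no factor is a β-power for any rational β ≥ 7/3; excluding only the exponent exactly 7/3 would make the claim false, since 0000 would then be a 7/3-power-free square that is not a conjugate of a word in 𝒜. -}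

module Defs where

open import Data.Digit using (Bit)
open import Data.Fin.Patterns using (0F; 1F)
open import Data.Integer using (+_)
open import Data.List using (List; []; _∷_; _++_; concat; concatMap; length; replicate)
open import Data.List.Membership.Propositional using (_∈_)
open import Data.List.NonEmpty as List⁺ using (List⁺)
open import Data.List.Relation.Binary.Infix.Heterogeneous using (Infix)
open import Data.List.Relation.Binary.Prefix.Heterogeneous using (Prefix)
open import Data.Nat using (ℕ)
open import Data.Product using (∃-syntax; ∃₂; _×_)
open import Data.Rational using (ℚ; _+_; _/_; _≤_)
open import Relation.Binary.PropositionalEquality using (_≡_)
open import Relation.Nullary using (¬_)
open import Relation.Unary using (Pred)
open import Level using (0ℓ)

Word : Set
Word = List Bit

open import Function.Endo.Propositional Word using (_^_)

infixr 8 _^ʷ_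

_^ʷ_ : Word → ℕ → Word
x ^ʷ n = concat (replicate n x)

IsPower : ℚ → Pred Word 0ℓ
IsPower α w =
  ∃[ x ] ∃[ n ] ∃[ x′ ]
    Prefix _≡_ x′ (List⁺.toList x) ×
    w ≡ List⁺.toList x ^ʷ n ++ x′ ×
    α ≡ (+ n / 1) + (+ length x′ / List⁺.length x)

Square : Pred Word 0ℓ
Square w = ∃[ x ] w ≡ List⁺.toList x ++ List⁺.toList x

-- Powers of every exponent β ≥ α are excluded, as is standard in
-- combinatorics on words.  Excluding only the exponent α itself would make
-- 0000 a 7/3-power-free word, since the length of a power of exponent
-- exactly 7/3 is a multiple of 7.
PowerFree : ℚ → Pred Word 0ℓ
PowerFree α w = ∀ {v} → Infix _≡_ v w → ∀ {β} → α ≤ β → ¬ IsPower β v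

Conjugate : Word → Word → Set
Conjugate x y = ∃₂ λ u v → x ≡ u ++ v × y ≡ v ++ u

ConjugatesOf : Pred Word 0ℓ → Pred Word 0ℓ
ConjugatesOf P y = ∃[ x ] P x × Conjugate x y

μ₁ : Bit → Word
μ₁ 0F = 0F ∷ 1F ∷ []
μ₁ 1F = 1F ∷ 0F ∷ []

μ : Word → Word
μ = concatMap μ₁

A : List Word
A = (0F ∷ 0F ∷ [])
  ∷ (1F ∷ 1F ∷ [])
  ∷ (0F ∷ 1F ∷ 0F ∷ 0F ∷ 1F ∷ 0F ∷ [])
  ∷ (1F ∷ 0F ∷ 1F ∷ 1F ∷ 0F ∷ 1F ∷ [])
  ∷ []

𝒜 : Pred Word 0ℓ
𝒜 w = ∃[ k ] ∃[ a ] a ∈ A × w ≡ (μ ^ k) a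

{-# OPTIONS --safe #-}
module Submission where

-- Squares of length 2m are read off sequences f of period m, and conjugation
-- is a shift of f.  A 7/3-power inside μ(t) cannot have odd period, and one of
-- even period gives a power of t with at least the same exponent, so μ
-- preserves freeness of all conjugates at once.  Conversely, for m ≥ 4,
-- freeness makes any two occurrences of aa or bb in f start an even distance
-- apart, so f is a shift by 0 or 1 of some μ(t), and t has period m/2.  When
-- the shift is 1, the last block of μ(t) sticks out of the square; the descent
-- therefore only assumes freeness of the first 2m − 1 letters, a hypothesis
-- that t inherits.

open import Defs
open import Data.Digit using (Bit)
open import Data.Fin.Patterns using (0F; 1F)
import Data.Fin.Properties as Fin
open import Data.Integer as ℤ using (+_)
import Data.Integer.Properties as ℤ
open import Data.List using ([]; _∷_; _++_; applyUpTo; length)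
open import Data.List.Membership.Propositional using (_∈_)
open import Data.List.NonEmpty as List⁺ using (_∷_)
open import Data.List.Properties
  using (length-++; length-applyUpTo; ++-assoc; ++-identityʳ; ∷-injective)
import Data.List.Relation.Binary.Infix.Heterogeneous as Infix
open Infix using (Infix)
import Data.List.Relation.Binary.Pointwise as Pointwise
import Data.List.Relation.Binary.Prefix.Heterogeneous as Prefix
open Prefix using (Prefix)
open import Data.List.Relation.Unary.Any using (here; there)
open import Data.Nat as Nat
  using (ℕ; zero; suc; _+_; _*_; _∸_; _⊓_; _<_; _≤_; z≤n; s≤s; z<s; s<s)
open import Data.Nat.DivMod using (_%_; m≡m%n+[m/n]*n; m%n<n; [m+n]%n≡m%n; m<n⇒m%n≡m)
open import Data.Nat.Induction using (<-wellFounded)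
open import Data.Nat.Properties
open import Data.Nat.Tactic.RingSolver using (solve-∀)
open import Data.Product using (∃-syntax; _×_; _,_; proj₁; proj₂)
open import Data.Rational as ℚ using (_/_)
import Data.Rational.Properties as ℚ
open import Data.Rational.Unnormalised as ℚᵘ using (mkℚᵘ)
import Data.Rational.Unnormalised.Properties as ℚᵘ
open import Data.Sum using (_⊎_; inj₁; inj₂; [_,_])
open import Function using (_∘_; case_of_)
open import Induction.WellFounded using (Acc; acc)
open import Relation.Binary.PropositionalEquality hiding ([_])
open import Relation.Nullary using (¬_; yes; no; contradiction)
open import Relation.Unary using (_∩_; _≐_)

-- The binary alphabet.

flip : Bit → Bit
flip 0F = 1F
flip 1F = 0F

b≢flip : ∀ b → b ≢ flip b
b≢flip 0F ()
b≢flip 1F ()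

≢⇒≡flip : ∀ {a b} → a ≢ b → b ≡ flip a
≢⇒≡flip {0F} {0F} a≢b = contradiction refl a≢b
≢⇒≡flip {0F} {1F} a≢b = refl
≢⇒≡flip {1F} {0F} a≢b = refl
≢⇒≡flip {1F} {1F} a≢b = contradiction refl a≢b

flip-involutive : ∀ b → flip (flip b) ≡ b
flip-involutive 0F = refl
flip-involutive 1F = refl

flip-injective : ∀ {a b} → flip a ≡ flip b → a ≡ b
flip-injective {a} {b} eq =
  trans (sym (flip-involutive a)) (trans (cong flip eq) (flip-involutive b))

≢-≢⇒≡ : ∀ {a b c} → a ≢ b → b ≢ c → a ≡ c
≢-≢⇒≡ {a} a≢b b≢c =
  sym (trans (≢⇒≡flip b≢c) (trans (cong flip (≢⇒≡flip a≢b)) (flip-involutive a)))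

half : ∀ n → ∃[ k ] (n ≡ k * 2 ⊎ n ≡ suc (k * 2))
half zero = 0 , inj₁ refl
half (suc n) with half n
... | k , inj₁ n≡2k = k , inj₂ (cong suc n≡2k)
... | k , inj₂ n≡1+2k = suc k , inj₁ (cong suc n≡1+2k)

-- Sequences, shifts and periods.

Sequence : Set
Sequence = ℕ → Bit

shift : ℕ → Sequence → Sequence
shift s f i = f (s + i)

Periodic : Sequence → ℕ → Set
Periodic f m = ∀ i → f (m + i) ≡ f i

shift-periodic : ∀ {f m} s → Periodic f m → Periodic (shift s f) m
shift-periodic {f} {m} s per i = trans (cong f (eq s m i)) (per (s + i))
  where
  eq : ∀ s m i → s + (m + i) ≡ m + (s + i)
  eq = solve-∀

*-periodic : ∀ {f m} → Periodic f m → ∀ k → Periodic f (k * m)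
*-periodic per zero i = refl
*-periodic {f} {m} per (suc k) i =
  trans (cong f (+-assoc m (k * m) i)) (trans (per (k * m + i)) (*-periodic per k i))

-- The morphism on sequences.

-- The recursion consumes two indices at a time, so that dropping a block agrees by computation with
-- dropping a letter of `t`.
μ∞ : Sequence → Sequence
μ∞ t zero = t 0
μ∞ t (suc zero) = flip (t 0)
μ∞ t (suc (suc i)) = μ∞ (t ∘ suc) i

μ∞-shift : ∀ n t i → μ∞ t (n * 2 + i) ≡ μ∞ (shift n t) i
μ∞-shift zero t i = refl
μ∞-shift (suc n) t i = μ∞-shift n (t ∘ suc) i

μ∞-even : ∀ k t → μ∞ t (k * 2) ≡ t k
μ∞-even zero t = refl
μ∞-even (suc k) t = μ∞-even k (t ∘ suc)

μ∞-odd : ∀ k t → μ∞ t (suc (k * 2)) ≡ flip (t k)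
μ∞-odd zero t = refl
μ∞-odd (suc k) t = μ∞-odd k (t ∘ suc)

μ∞-cong-< : ∀ {t u} n → (∀ i → i < n → t i ≡ u i) → ∀ i → i < n * 2 → μ∞ t i ≡ μ∞ u i
μ∞-cong-< (suc n) t≈u zero _ = t≈u 0 z<s
μ∞-cong-< (suc n) t≈u (suc zero) _ = cong flip (t≈u 0 z<s)
μ∞-cong-< (suc n) t≈u (suc (suc i)) (s≤s (s≤s i<2n)) =
  μ∞-cong-< n (λ j j<n → t≈u (suc j) (s<s j<n)) i i<2n

μ∞-cong : ∀ {t u} → t ≗ u → μ∞ t ≗ μ∞ u
μ∞-cong t≈u zero = t≈u 0
μ∞-cong t≈u (suc zero) = cong flip (t≈u 0)
μ∞-cong t≈u (suc (suc i)) = μ∞-cong (t≈u ∘ suc) i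

μ∞-periodic : ∀ {t} m → Periodic t m → Periodic (μ∞ t) (m * 2)
μ∞-periodic {t} m per i = trans (μ∞-shift m t i) (μ∞-cong per i)

-- Two distinct bits are always some `b` and `flip b`, the image of `b`.
≢⇒μ∞ : ∀ f → (∀ k → f (k * 2) ≢ f (suc (k * 2))) → f ≗ μ∞ (λ k → f (k * 2))
≢⇒μ∞ f f≢ zero = refl
≢⇒μ∞ f f≢ (suc zero) = ≢⇒≡flip (f≢ 0)
≢⇒μ∞ f f≢ (suc (suc i)) = ≢⇒μ∞ (f ∘ suc ∘ suc) (f≢ ∘ suc) i

-- Powers of exponent at least 7/3 under the morphism.

-- The first p + n letters form a power of period p and exponent at least 7/3.
record HighPower (f : Sequence) (p n : ℕ) : Set where
  constructor highPower
  field
    positive : 0 < p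
    excess   : 4 * p ≤ 3 * n
    repeats  : ∀ i → i < n → f i ≡ f (p + i)

  p<n : p < n
  p<n = *-cancelˡ-< 3 p n (<-≤-trans (+-monoˡ-< (3 * p) positive) excess)

HighPower-cong : ∀ {f g p n} → f ≗ g → HighPower f p n → HighPower g p n
HighPower-cong {p = p} f≈g (highPower pos exc rep) =
  highPower pos exc λ i i<n → trans (sym (f≈g i)) (trans (rep i i<n) (f≈g (p + i)))

-- Doubling both lengths keeps the exponent; contrapositively, freeness of an image passes to its
-- preimage.
μ∞-HighPower : ∀ {t p n} → HighPower t p n → HighPower (μ∞ t) (p * 2) (n * 2)
μ∞-HighPower {t} {p} {n} (highPower pos exc rep) = highPower
  (*-monoˡ-< 2 pos)
  (subst₂ _≤_ (*-assoc 4 p 2) (*-assoc 3 n 2) (*-monoˡ-≤ 2 exc))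
  λ i i<2n → trans (μ∞-cong-< n rep i i<2n) (sym (μ∞-shift p t i))

-- Two consecutive changes of bit restore it, so an odd number of changes amounts to one.
alternating : ∀ (f : Sequence) q → (∀ i → i < suc (q * 2) → f i ≢ f (suc i)) → f 0 ≢ f (suc (q * 2))
alternating f zero alt = alt 0 z<s
alternating f (suc q) alt f0≡ =
  alternating (f ∘ suc ∘ suc) q (λ i i< → alt (suc (suc i)) (s<s (s<s i<)))
    (trans (sym (≢-≢⇒≡ (alt 0 z<s) (alt 1 (s<s z<s)))) f0≡)

μ∞-even≢ : ∀ t k → μ∞ t (k * 2) ≢ μ∞ t (suc (k * 2))
μ∞-even≢ t k eq = b≢flip (t k) (trans (sym (μ∞-even k t)) (trans eq (μ∞-odd k t)))

-- One of two positions an odd distance apart starts a block of μ, so the power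
-- alternates; but then letters an odd distance apart differ.
μ∞-oddPeriod : ∀ t s q {n} → ¬ HighPower (shift s (μ∞ t)) (suc (q * 2)) n
μ∞-oddPeriod t s q {n} h =
  alternating g q alt (subst (λ i → g 0 ≡ g i) (+-identityʳ p) (repeats 0 (≤-trans z<s p<n)))
  where
  open HighPower h
  p = suc (q * 2)
  g = shift s (μ∞ t)
  odd+odd : ∀ k q → suc (k * 2) + suc (q * 2) ≡ suc (k + q) * 2
  odd+odd = solve-∀
  swap : ∀ s p i → s + (p + i) ≡ s + i + p
  swap = solve-∀
  alt : ∀ i → i < p → g i ≢ g (suc i)
  alt i i<p gi≡ with half (s + i)
  ... | k , inj₁ s+i≡ = μ∞-even≢ t k
    (subst (λ j → μ∞ t j ≡ μ∞ t (suc j)) s+i≡ (trans gi≡ (cong (μ∞ t) (+-suc s i))))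
  ... | k , inj₂ s+i≡ = μ∞-even≢ t (suc (k + q))
    (subst (λ j → μ∞ t j ≡ μ∞ t (suc j))
      (trans (swap s p i) (trans (cong (_+ p) s+i≡) (odd+odd k q)))
      -- As p < n, both i and i + 1 are below n, so the equality of neighbours moves by p, to the
      -- start of a block.
      (trans (sym (repeats i (<-trans i<p p<n)))
        (trans gi≡ (trans (repeats (suc i) (≤-<-trans i<p p<n))
          (cong (μ∞ t) (trans (cong (λ j → s + suc j) (+-suc (q * 2) i)) (+-suc s (p + i))))))))

-- When `t` has period m, a power of length at most `m * 2` starting anywhere lies in a conjugate of
-- the square of length `m * 2`; hence the start `s` is unbounded.
CircularlyFree : ℕ → Sequence → Set
CircularlyFree m t = ∀ s {p n} → p + n ≤ m * 2 → ¬ HighPower (shift s t) p n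

-- Every second letter of the power is kept: all are first letters of blocks, or all are second
-- letters, according to the parity of `s`. `N` is n/2 rounded up, so no exponent is lost, and every
-- sampled index 2i with i < N is still below n.
μ∞-desample : ∀ t s q n N → N * 2 ≤ suc n → n ≤ N * 2 →
  HighPower (shift s (μ∞ t)) (q * 2) n → ∃[ s′ ] HighPower (shift s′ t) q N
μ∞-desample t s q n N 2N≤1+n n≤2N (highPower pos exc rep) with half s
... | k , s≡ = k , highPower
  (*-cancelʳ-< 2 0 q pos)
  (*-cancelʳ-≤ (4 * q) (3 * N) 2
    (subst₂ _≤_ (sym (*-assoc 4 q 2)) (sym (*-assoc 3 N 2)) (≤-trans exc (*-monoʳ-≤ 3 n≤2N))))
  λ i i<N → sample s≡ i (rep (i * 2) (≤-pred (≤-trans (*-monoˡ-≤ 2 i<N) 2N≤1+n)))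
  where
  even : ∀ k i → k * 2 + i * 2 ≡ (k + i) * 2
  even = solve-∀
  even′ : ∀ k q i → k * 2 + (q * 2 + i * 2) ≡ (k + (q + i)) * 2
  even′ = solve-∀
  sample : (s ≡ k * 2 ⊎ s ≡ suc (k * 2)) → ∀ i →
    shift s (μ∞ t) (i * 2) ≡ shift s (μ∞ t) (q * 2 + i * 2) → shift k t i ≡ shift k t (q + i)
  sample (inj₁ refl) i eq = begin
    t (k + i)                          ≡⟨ μ∞-even (k + i) t ⟨
    μ∞ t ((k + i) * 2)                 ≡⟨ cong (μ∞ t) (even k i) ⟨
    μ∞ t (k * 2 + i * 2)               ≡⟨ eq ⟩
    μ∞ t (k * 2 + (q * 2 + i * 2))     ≡⟨ cong (μ∞ t) (even′ k q i) ⟩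
    μ∞ t ((k + (q + i)) * 2)           ≡⟨ μ∞-even (k + (q + i)) t ⟩
    t (k + (q + i))                    ∎
    where open ≡-Reasoning
  sample (inj₂ refl) i eq = flip-injective (begin
    flip (t (k + i))                     ≡⟨ μ∞-odd (k + i) t ⟨
    μ∞ t (suc ((k + i) * 2))             ≡⟨ cong (μ∞ t ∘ suc) (even k i) ⟨
    μ∞ t (suc (k * 2) + i * 2)           ≡⟨ eq ⟩
    μ∞ t (suc (k * 2) + (q * 2 + i * 2)) ≡⟨ cong (μ∞ t ∘ suc) (even′ k q i) ⟩
    μ∞ t (suc ((k + (q + i)) * 2))       ≡⟨ μ∞-odd (k + (q + i)) t ⟩
    flip (t (k + (q + i)))               ∎)
    where open ≡-Reasoning

μ∞-free : ∀ {m t} → CircularlyFree m t → CircularlyFree (m * 2) (μ∞ t)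
μ∞-free {m} {t} free s {p} {n} p+n≤ h with half p
... | q , inj₂ refl = μ∞-oddPeriod t s q h
... | q , inj₁ refl with half n
...   | N , inj₁ refl =
  let s′ , h′ = μ∞-desample t s q (N * 2) N (n≤1+n _) ≤-refl h
  in free s′ (*-cancelʳ-≤ (q + N) (m * 2) 2 (subst (_≤ m * 2 * 2) (sym (*-distribʳ-+ 2 q N)) p+n≤)) h′
...   | N , inj₂ refl =
  let s′ , h′ = μ∞-desample t s q (suc (N * 2)) (suc N) ≤-refl (n≤1+n _) h
  in free s′
       -- Rounding n = 2N + 1 up does not spoil the length: 2q + 2N + 1 ≤ 4m forces q + N + 1 ≤ 2m.
       (subst (_≤ m * 2) (sym (+-suc q N))
         (*-cancelʳ-< 2 (q + N) (m * 2) (subst (_≤ m * 2 * 2) (eq q N) p+n≤)))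
       h′
  where
  eq : ∀ q N → q * 2 + suc (N * 2) ≡ suc ((q + N) * 2)
  eq = solve-∀

-- The periodic sequences behind `𝒜`.

tri : Bit → Sequence
tri b 0 = b
tri b 1 = flip b
tri b 2 = b
tri b (suc (suc (suc i))) = tri b i

-- The first 2m letters of these sequences of period m are the words of 𝒜.
data Root : ℕ → Sequence → Set where
  const : ∀ b → Root 1 (λ _ → b)
  aba   : ∀ b → Root 3 (tri b)
  image : ∀ {m t} → Root m t → Root (m * 2) (μ∞ t)

Root-positive : ∀ {m t} → Root m t → 0 < m
Root-positive (const b) = z<s
Root-positive (aba b) = z<s
Root-positive (image r) = *-monoˡ-< 2 (Root-positive r)

Root-periodic : ∀ {m t} → Root m t → Periodic t m
Root-periodic (const b) i = refl
Root-periodic (aba b) i = refl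
Root-periodic (image {m} r) = μ∞-periodic m (Root-periodic r)

tri-noCube : ∀ b s → shift s (tri b) 0 ≡ shift s (tri b) 1 → shift s (tri b) 1 ≢ shift s (tri b) 2
tri-noCube b 0 eq _ = b≢flip b eq
tri-noCube b 1 eq _ = b≢flip b (sym eq)
tri-noCube b 2 _ eq = b≢flip b eq
tri-noCube b (suc (suc (suc s))) = tri-noCube b s

tri-no5 : ∀ b s → shift s (tri b) 0 ≡ shift s (tri b) 2 → shift s (tri b) 1 ≡ shift s (tri b) 3 →
  shift s (tri b) 2 ≢ shift s (tri b) 4
tri-no5 b 0 _ _ eq = b≢flip b eq
tri-no5 b 1 eq _ _ = b≢flip b (sym eq)
tri-no5 b 2 eq _ _ = b≢flip b eq
tri-no5 b (suc (suc (suc s))) = tri-no5 b s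

-- In the base cases length almost decides: exponent at least 7/3 means length at least 3 for period
-- 1, 5 for period 2 and 7 from period 3 on, while only 2 or 6 letters are available.
Root-free : ∀ {m t} → Root m t → CircularlyFree m t
Root-free (image {m} r) = μ∞-free {m} (Root-free r)
Root-free (const b) s p+n≤2 h =
  <⇒≱ (s≤s (+-mono-≤ positive (≤-<-trans positive p<n))) (s≤s p+n≤2)
  where open HighPower h
Root-free (aba b) s {1} p+n≤6 h =
  tri-noCube b s (repeats 0 (<-trans z<s p<n)) (repeats 1 p<n)
  where open HighPower h
Root-free (aba b) s {2} p+n≤6 h =
  tri-no5 b s (repeats 0 (≤-<-trans z≤n p<n)) (repeats 1 (≤-<-trans (s≤s z≤n) p<n)) (repeats 2 p<n)
  where open HighPower h
Root-free (aba b) s {suc (suc (suc p))} p+n≤6 h =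
  <⇒≱ (+-mono-≤ {3} (s≤s (s≤s (s≤s z≤n))) (≤-<-trans (s≤s (s≤s (s≤s z≤n))) p<n)) p+n≤6
  where open HighPower h

-- Parsing a sparse sequence into blocks.

-- The shortest powers of periods 1, 2 and 3 with exponent at least 7/3 are excluded at every
-- position.
record Sparse (f : Sequence) : Set where
  field
    noCube : ∀ i → f i ≡ f (1 + i) → f (1 + i) ≢ f (2 + i)
    no5    : ∀ i → f i ≡ f (2 + i) → f (1 + i) ≡ f (3 + i) → f (2 + i) ≢ f (4 + i)
    no7    : ∀ i → f i ≡ f (3 + i) → f (1 + i) ≡ f (4 + i) → f (2 + i) ≡ f (5 + i) →
             f (3 + i) ≢ f (6 + i)

Sparse-shift : ∀ k {f} → Sparse f → Sparse (shift k f)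
Sparse-shift zero sp = sp
Sparse-shift (suc k) {f} sp = Sparse-shift k record
  { noCube = noCube ∘ suc ; no5 = no5 ∘ suc ; no7 = no7 ∘ suc }
  where open Sparse sp

-- Without a double, five letters would read ababa.
double-in-4 : ∀ {f} → Sparse f →
  f 0 ≡ f 1 ⊎ f 1 ≡ f 2 ⊎ f 2 ≡ f 3 ⊎ f 3 ≡ f 4
double-in-4 {f} sp with f 0 Fin.≟ f 1 | f 1 Fin.≟ f 2 | f 2 Fin.≟ f 3 | f 3 Fin.≟ f 4
... | yes eq | _ | _ | _ = inj₁ eq
... | no _ | yes eq | _ | _ = inj₂ (inj₁ eq)
... | no _ | no _ | yes eq | _ = inj₂ (inj₂ (inj₁ eq))
... | no _ | no _ | no _ | yes eq = inj₂ (inj₂ (inj₂ eq))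
... | no 0≢1 | no 1≢2 | no 2≢3 | no 3≢4 =
  contradiction (≢-≢⇒≡ 2≢3 3≢4) (Sparse.no5 sp 0 (≢-≢⇒≡ 0≢1 1≢2) (≢-≢⇒≡ 1≢2 2≢3))

-- The letter f 0 is needed: aabaa is sparse, but baabaab is not.
no-doubles-at-distance-3 : ∀ {f} → Sparse f → f 1 ≡ f 2 → f 4 ≢ f 5
no-doubles-at-distance-3 {f} sp 1≡2 4≡5 = no7 0
  (≢-≢⇒≡ 0≢1 (λ 1≡3 → 2≢3 (trans (sym 1≡2) 1≡3)))
  (≢-≢⇒≡ (λ 1≡3 → 2≢3 (trans (sym 1≡2) 1≡3)) 3≢4)
  (≢-≢⇒≡ 2≢3 (λ 3≡5 → 3≢4 (trans 3≡5 (sym 4≡5))))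
  (≢-≢⇒≡ 3≢4 (λ 4≡6 → noCube 4 4≡5 (trans (sym 4≡5) 4≡6)))
  where
  open Sparse sp
  0≢1 : f 0 ≢ f 1
  0≢1 0≡1 = noCube 0 0≡1 1≡2
  2≢3 : f 2 ≢ f 3
  2≢3 = noCube 1 1≡2
  3≢4 : f 3 ≢ f 4
  3≢4 3≡4 = noCube 3 3≡4 4≡5

-- Some double begins at one of the positions 2 to 5. At 2 it makes a cube, at 4 it is at distance 3
-- from the first double; from 3 or 5 the distance to the last double is again odd, and smaller.
no-doubles-at-odd-distance : ∀ k {f} → Sparse f → f 1 ≡ f 2 → f (2 + k * 2) ≢ f (3 + k * 2)
no-doubles-at-odd-distance 0 sp 1≡2 = Sparse.noCube sp 1 1≡2
no-doubles-at-odd-distance 1 sp 1≡2 = no-doubles-at-distance-3 sp 1≡2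
no-doubles-at-odd-distance (suc (suc k)) sp 1≡2 end =
  [ Sparse.noCube sp 1 1≡2
  , [ (λ 3≡4 → no-doubles-at-odd-distance (suc k) (Sparse-shift 2 sp) 3≡4 end)
    , [ no-doubles-at-distance-3 sp 1≡2
      , (λ 5≡6 → no-doubles-at-odd-distance k (Sparse-shift 4 sp) 5≡6 end) ] ] ]
  (double-in-4 (Sparse-shift 2 sp))

-- The double at 1 excludes doubles at the even indices from 2 on, so the letters from 2 on pair up
-- into blocks. An odd period would itself carry the double to an even index.
desubstitute-from-double : ∀ {f m} → Periodic f m → Sparse f → f 1 ≡ f 2 →
  ∃[ h ] m ≡ h * 2 × ∃[ t ] shift 2 f ≗ μ∞ t
desubstitute-from-double {f} {m} per sp 1≡2 with half m
... | h , inj₁ m≡2h =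
  h , m≡2h , _ , ≢⇒μ∞ (shift 2 f) (λ k → no-doubles-at-odd-distance k sp 1≡2)
... | h , inj₂ m≡1+2h =
  contradiction (trans (wrap 1) (trans 1≡2 (sym (wrap 2)))) (no-doubles-at-odd-distance h sp 1≡2)
  where
  wrap : ∀ i → f (i + (1 + h * 2)) ≡ f i
  wrap i = trans (cong f (trans (cong (λ n → i + n) (sym m≡1+2h)) (+-comm i m))) (per i)

desubstitute : ∀ {f m} → Periodic f m → Sparse f →
  ∃[ h ] m ≡ h * 2 × ∃[ e ] ∃[ t ] shift e f ≗ μ∞ t
-- The search begins at index 1, because the double needs a letter before it.
desubstitute {f} {m} per sp = case double-in-4 (Sparse-shift 1 sp) of λ where
    (inj₁ 1≡2) → from 0 1≡2
    (inj₂ (inj₁ 2≡3)) → from 1 2≡3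
    (inj₂ (inj₂ (inj₁ 3≡4))) → from 2 3≡4
    (inj₂ (inj₂ (inj₂ 4≡5))) → from 3 4≡5
  where
  from : ∀ k → shift k f 1 ≡ shift k f 2 → ∃[ h ] m ≡ h * 2 × ∃[ e ] ∃[ t ] shift e f ≗ μ∞ t
  from k eq
    with h , m≡2h , t , eq′ ←
      desubstitute-from-double (shift-periodic {f} k per) (Sparse-shift k sp) eq =
    h , m≡2h , k + 2 , t , λ i → trans (cong f (+-assoc k 2 i)) (eq′ i)

-- Over a full period 2h the offset of a parsing into blocks only matters modulo 2.
reduce-offset : ∀ {f} h → Periodic f (suc h * 2) → ∀ e {t} → shift e f ≗ μ∞ t →
  ∃[ ε ] ε ≤ 1 × ∃[ u ] shift ε f ≗ μ∞ u
reduce-offset h per zero eq = 0 , z≤n , _ , eq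
reduce-offset h per (suc zero) eq = 1 , s≤s z≤n , _ , eq
reduce-offset {f} h per (suc (suc e)) {t} eq = reduce-offset h per e {shift h t} λ i →
  -- A full period after e + i comes e + 2 + (2h + i), so the parsing at e + 2 gives one at e, with
  -- `t` advanced by h blocks.
  trans (sym (per (e + i)))
    (trans (cong (f ∘ suc ∘ suc) (swap (h * 2) e i)) (trans (eq (h * 2 + i)) (μ∞-shift h t i)))
  where
  swap : ∀ a e i → a + (e + i) ≡ e + (a + i)
  swap = solve-∀

-- Passing to the preimage.

-- The bound is strict: for N = 2m the last letter of the square is left out.
FreeBelow : ℕ → Sequence → Set
FreeBelow N f = ∀ s {p n} → s + (p + n) < N → ¬ HighPower (shift s f) p n

preimage-periodic : ∀ {f t} h ε → Periodic f (h * 2) → shift ε f ≗ μ∞ t → Periodic t h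
preimage-periodic {f} {t} h ε per eq k = begin
  t (h + k)             ≡⟨ μ∞-even (h + k) t ⟨
  μ∞ t ((h + k) * 2)    ≡⟨ eq ((h + k) * 2) ⟨
  f (ε + (h + k) * 2)   ≡⟨ cong f (swap ε h k) ⟩
  f (h * 2 + (ε + k * 2)) ≡⟨ per (ε + k * 2) ⟩
  f (ε + k * 2)         ≡⟨ eq (k * 2) ⟩
  μ∞ t (k * 2)          ≡⟨ μ∞-even k t ⟩
  t k                   ∎
  where
  open ≡-Reasoning
  swap : ∀ ε h k → ε + (h + k) * 2 ≡ h * 2 + (ε + k * 2)
  swap = solve-∀

-- A power of `t` doubles to a power of `f` ending at ε + 2(s + p + n). From s + p + n ≤ 2h - 1 this
-- is at most 4h - 1: the strict bound absorbs the offset.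
preimage-free : ∀ {f t} h ε → ε ≤ 1 → FreeBelow (h * 2 * 2) f → shift ε f ≗ μ∞ t → FreeBelow (h * 2) t
preimage-free {f} {t} h ε ε≤1 free eq s {p} {n} s+p+n< power =
  free (ε + s * 2)
    (≤-trans (s≤s (+-monoˡ-≤ _ (+-monoˡ-≤ (s * 2) ε≤1)))
      (subst (_≤ h * 2 * 2) (bound s p n) (*-monoˡ-≤ 2 s+p+n<)))
    (HighPower-cong
      (λ i → trans (sym (μ∞-shift s t i))
        (trans (sym (eq (s * 2 + i))) (cong f (sym (+-assoc ε (s * 2) i)))))
      (μ∞-HighPower power))
  where
  bound : ∀ s p n → suc (s + (p + n)) * 2 ≡ 2 + s * 2 + (p * 2 + n * 2)
  bound = solve-∀

-- From freeness to sparseness.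

power₁ : ∀ {f} → f 0 ≡ f 1 → f 1 ≡ f 2 → HighPower f 1 2
power₁ e₀ e₁ = highPower z<s (m≤m+n 4 2) λ where
  0 _ → e₀
  1 _ → e₁
  (suc (suc _)) (s≤s (s≤s ()))

power₂ : ∀ {f} → f 0 ≡ f 2 → f 1 ≡ f 3 → f 2 ≡ f 4 → HighPower f 2 3
power₂ e₀ e₁ e₂ = highPower z<s (m≤m+n 8 1) λ where
  0 _ → e₀
  1 _ → e₁
  2 _ → e₂
  (suc (suc (suc _))) (s≤s (s≤s (s≤s ())))

power₃ : ∀ {f} → f 0 ≡ f 3 → f 1 ≡ f 4 → f 2 ≡ f 5 → f 3 ≡ f 6 → HighPower f 3 4
power₃ e₀ e₁ e₂ e₃ = highPower z<s ≤-refl λ where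
  0 _ → e₀
  1 _ → e₁
  2 _ → e₂
  3 _ → e₃
  (suc (suc (suc (suc _)))) (s≤s (s≤s (s≤s (s≤s ()))))

shift-% : ∀ {f} m → Periodic f (suc m) → ∀ s → shift s f ≗ shift (s % suc m) f
shift-% {f} m per s i = begin
  f (s + i)         ≡⟨ cong (λ s → f (s + i)) (m≡m%n+[m/n]*n s (suc m)) ⟩
  f (r + q + i)     ≡⟨ cong f (swap r q i) ⟩
  f (q + (r + i))   ≡⟨ *-periodic {f} per (s Nat./ suc m) (r + i) ⟩
  f (r + i)         ∎
  where
  open ≡-Reasoning
  r = s % suc m
  q = s Nat./ suc m * suc m
  swap : ∀ r q i → r + q + i ≡ q + (r + i)
  swap = solve-∀

-- Modulo the period the start is less than the period, so the power ends early enough. Writing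
-- `f (i + s)` rather than `shift s f` lets numerals compute to the terms of `Sparse`.
free-everywhere : ∀ {f} m → Periodic f (suc m) → FreeBelow (suc m * 2) f →
  ∀ s {p n} → p + n ≤ suc m → ¬ HighPower (λ i → f (i + s)) p n
free-everywhere {f} m per free s {p} {n} p+n≤m power =
  free (s % suc m)
    (subst (s % suc m + (p + n) <_) (double (suc m)) (+-mono-<-≤ (m%n<n s (suc m)) p+n≤m))
    (HighPower-cong (λ i → trans (cong f (+-comm i s)) (shift-% m per s i)) power)
  where
  double : ∀ m → m + m ≡ m * 2
  double = solve-∀

-- The index s full periods beyond i is at or past s, where `rep` applies; the periods are then
-- removed again.
unshift-repeats : ∀ {f} m → Periodic f (suc m) → ∀ p s →
  (∀ i → f (i + s) ≡ f (p + i + s)) → ∀ i → f i ≡ f (p + i)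
unshift-repeats {f} m per p s rep i = begin
  f i                     ≡⟨ *-periodic {f} per s i ⟨
  f (s * suc m + i)       ≡⟨ cong f (eq₁ s m i) ⟩
  f (s * m + i + s)       ≡⟨ rep (s * m + i) ⟩
  f (p + (s * m + i) + s) ≡⟨ cong f (eq₂ s m i p) ⟩
  f (s * suc m + (p + i)) ≡⟨ *-periodic {f} per s (p + i) ⟩
  f (p + i)               ∎
  where
  open ≡-Reasoning
  eq₁ : ∀ s m i → s * suc m + i ≡ s * m + i + s
  eq₁ = solve-∀
  eq₂ : ∀ s m i p → p + (s * m + i) + s ≡ s * suc m + (p + i)
  eq₂ = solve-∀

repeats₂ : ∀ {f} → Periodic f 4 → f 0 ≡ f 2 → f 1 ≡ f 3 → ∀ i → f i ≡ f (2 + i)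
repeats₂ per e₀ e₁ 0 = e₀
repeats₂ per e₀ e₁ 1 = e₁
repeats₂ per e₀ e₁ (suc (suc i)) = trans (sym (repeats₂ per e₀ e₁ i)) (sym (per i))

repeats₃ : ∀ {f} → Periodic f 6 → f 0 ≡ f 3 → f 1 ≡ f 4 → f 2 ≡ f 5 → ∀ i → f i ≡ f (3 + i)
repeats₃ per e₀ e₁ e₂ 0 = e₀
repeats₃ per e₀ e₁ e₂ 1 = e₁
repeats₃ per e₀ e₁ e₂ 2 = e₂
repeats₃ per e₀ e₁ e₂ (suc (suc (suc i))) = trans (sym (repeats₃ per e₀ e₁ e₂ i)) (sym (per i))

-- A factor of length at most the period occurs in every window of 2m − 1
-- letters.  For the shorter periods: 3 and m ∈ {4, 5} combine to a cube, and a
-- repetition of period m/2 spreads to the whole of f.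
free⇒sparse : ∀ {f} m → Periodic f (4 + m) → FreeBelow ((4 + m) * 2) f → Sparse f
free⇒sparse {f} m per free = record
  { noCube = noCube ; no5 = no5 m per free ; no7 = no7 m per free noCube }
  where
  NoCube = ∀ i → f i ≡ f (1 + i) → f (1 + i) ≢ f (2 + i)

  noCube : NoCube
  noCube s e₀ e₁ = free-everywhere _ per free s (m≤m+n 3 (suc m)) (power₁ e₀ e₁)

  no5 : ∀ m → Periodic f (4 + m) → FreeBelow ((4 + m) * 2) f →
    ∀ i → f i ≡ f (2 + i) → f (1 + i) ≡ f (3 + i) → f (2 + i) ≢ f (4 + i)
  no5 (suc m) per free s e₀ e₁ e₂ = free-everywhere _ per free s (m≤m+n 5 m) (power₂ e₀ e₁ e₂)
  no5 zero per free s e₀ e₁ _ = free 0 (m≤m+n 6 2) (power₂ (rep 0) (rep 1) (rep 2))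
    where
    rep : ∀ i → f i ≡ f (2 + i)
    rep = unshift-repeats _ per 2 s (repeats₂ (λ i → per (i + s)) e₀ e₁)

  no7 : ∀ m → Periodic f (4 + m) → FreeBelow ((4 + m) * 2) f → NoCube →
    ∀ i → f i ≡ f (3 + i) → f (1 + i) ≡ f (4 + i) → f (2 + i) ≡ f (5 + i) → f (3 + i) ≢ f (6 + i)
  no7 0 per free noCube s e₀ e₁ e₂ _ =
    noCube s (sym (trans e₁ (per s))) (sym (trans e₂ (per (1 + s))))
  no7 1 per free noCube s e₀ e₁ e₂ e₃ = noCube s
    (trans e₀ (trans e₃ (per (1 + s))))
    (trans (sym (trans e₀ (trans e₃ (per (1 + s))))) (sym (trans e₂ (per s))))
  no7 2 per free _ s e₀ e₁ e₂ _ = free 0 (m≤m+n 8 4) (power₃ (rep 0) (rep 1) (rep 2) (rep 3))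
    where
    rep : ∀ i → f i ≡ f (3 + i)
    rep = unshift-repeats _ per 3 s (repeats₃ (λ i → per (i + s)) e₀ e₁ e₂)
  no7 (suc (suc (suc m))) per free _ s e₀ e₁ e₂ e₃ =
    free-everywhere _ per free s (m≤m+n 7 m) (power₃ e₀ e₁ e₂ e₃)

-- Descent to the roots.

Rooted : Sequence → ℕ → Set
Rooted f m = ∃[ t ] Root m t × ∃[ s ] f ≗ shift s t

agree₃ : ∀ {f g} → Periodic f 3 → Periodic g 3 → f 0 ≡ g 0 → f 1 ≡ g 1 → f 2 ≡ g 2 → f ≗ g
agree₃ perf perg e₀ e₁ e₂ 0 = e₀
agree₃ perf perg e₀ e₁ e₂ 1 = e₁
agree₃ perf perg e₀ e₁ e₂ 2 = e₂
agree₃ perf perg e₀ e₁ e₂ (suc (suc (suc i))) =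
  trans (perf i) (trans (agree₃ perf perg e₀ e₁ e₂ i) (sym (perg i)))

rooted₁ : ∀ {f} → Periodic f 1 → Rooted f 1
rooted₁ {f} per = _ , const (f 0) , 0 , constant
  where
  constant : ∀ i → f i ≡ f 0
  constant zero = refl
  constant (suc i) = trans (per i) (constant i)

rooted₂ : ∀ {f} → Periodic f 2 → FreeBelow 4 f → Rooted f 2
rooted₂ {f} per free = _ , image (const (f 0)) , 0 , alternate
  where
  alternate : ∀ i → f i ≡ μ∞ (λ _ → f 0) i
  alternate 0 = refl
  -- With period 2, aa extends to the cube aaa, whose three letters are just what `FreeBelow 4`
  -- covers.
  alternate 1 = ≢⇒≡flip λ 0≡1 → free 0 ≤-refl (power₁ 0≡1 (trans (sym 0≡1) (sym (per 0))))
  alternate (suc (suc i)) = trans (per i) (alternate i)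

rooted₃ : ∀ {f} → Periodic f 3 → FreeBelow 6 f → Rooted f 3
rooted₃ {f} per free with f 0 Fin.≟ f 1 | f 1 Fin.≟ f 2
... | yes 0≡1 | yes 1≡2 = contradiction (power₁ 0≡1 1≡2) (free 0 (m≤m+n 4 2))
-- aab is the rotation of aba by 2; in the next case abb is that of bab by 1.
... | yes 0≡1 | no 1≢2 = _ , aba (f 0) , 2 ,
  agree₃ per (λ _ → refl) refl (sym 0≡1) (trans (≢⇒≡flip 1≢2) (cong flip (sym 0≡1)))
... | no 0≢1 | yes 1≡2 = _ , aba (f 1) , 1 ,
  agree₃ per (λ _ → refl) (≢⇒≡flip (0≢1 ∘ sym)) refl (sym 1≡2)
... | no 0≢1 | no 1≢2 = _ , aba (f 0) , 0 ,
  agree₃ per (λ _ → refl) refl (≢⇒≡flip 0≢1) (sym (≢-≢⇒≡ 0≢1 1≢2))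

image-rooted : ∀ {f t h} e → Periodic f (suc h * 2) → shift e f ≗ μ∞ t →
  Rooted t (suc h) → Rooted f (suc h * 2)
image-rooted {f} {t} {h} e per eq (u , root , s , t≗) = μ∞ u , image root , s * 2 + k , λ i → begin
  f i                         ≡⟨ *-periodic {f} per e i ⟨
  f (e * (suc h * 2) + i)     ≡⟨ cong f (swap e h i) ⟩
  f (e + (k + i))             ≡⟨ eq (k + i) ⟩
  μ∞ t (k + i)                ≡⟨ μ∞-cong t≗ (k + i) ⟩
  μ∞ (shift s u) (k + i)      ≡⟨ μ∞-shift s u (k + i) ⟨
  μ∞ u (s * 2 + (k + i))      ≡⟨ cong (μ∞ u) (+-assoc (s * 2) k i) ⟨
  μ∞ u (s * 2 + k + i)        ∎
  where
  open ≡-Reasoning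
  -- e full periods are e + k, so moving forward by k undoes the offset e without subtraction.
  k = e * suc (h * 2)
  swap : ∀ e h i → e * (suc h * 2) + i ≡ e + (e * suc (h * 2) + i)
  swap = solve-∀

-- Each step halves the period, hence the well-founded recursion; periods below 4 are out of reach
-- of `free⇒sparse`.
free⇒rooted : ∀ {f} m → 0 < m → Acc _<_ m → Periodic f m → FreeBelow (m * 2) f → Rooted f m
free⇒rooted 1 _ _ per free = rooted₁ per
free⇒rooted 2 _ _ per free = rooted₂ per free
free⇒rooted 3 _ _ per free = rooted₃ per free
free⇒rooted {f} (suc (suc (suc (suc m)))) _ (acc rec) per free
  with desubstitute per (free⇒sparse m per free)
... | suc h , m≡2h , e , t , eq
  with per′ ← subst (Periodic f) m≡2h per
  -- The parsing found may start far out, while `preimage-free` tolerates an offset of at most 1.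
  with ε , ε≤1 , u , eq′ ← reduce-offset h per′ e eq =
  subst (Rooted f) (sym m≡2h) (image-rooted ε per′ eq′
    (free⇒rooted (suc h) z<s (rec (subst (suc h <_) (sym m≡2h) (m<m*n (suc h) 2 (s≤s (s≤s z≤n)))))
      (preimage-periodic (suc h) ε per′ eq′)
      (preimage-free {f} (suc h) ε ε≤1 (subst (λ m → FreeBelow (m * 2) f) m≡2h free) eq′)))

-- The exponent inequality in natural numbers.

-- Unnormalised fractions add by cross-multiplication without reduction, which turns the comparison
-- with 7/3 into one of integers. The factor 3 is the denominator of 7/3.
exponent-numerator : ∀ n r d →
  ℚᵘ.↥ (mkℚᵘ (+ n) 0 ℚᵘ.+ mkℚᵘ (+ r) d) ℤ.* + 3 ≡ + (3 * (n * suc d + r))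
exponent-numerator n r d = begin
  (+ n ℤ.* + suc d ℤ.+ + r ℤ.* + 1) ℤ.* + 3  ≡⟨ cong (ℤ._* + 3) (cong₂ ℤ._+_ (ℤ.pos-* n (suc d)) (ℤ.pos-* r 1)) ⟨
  + (n * suc d + r * 1) ℤ.* + 3              ≡⟨ ℤ.pos-* (n * suc d + r * 1) 3 ⟨
  + ((n * suc d + r * 1) * 3)                ≡⟨ cong +_ (eq (n * suc d) r) ⟩
  + (3 * (n * suc d + r))                    ∎
  where
  open ≡-Reasoning
  eq : ∀ a r → (a + r * 1) * 3 ≡ 3 * (a + r)
  eq = solve-∀

exponent-denominator : ∀ d → + 7 ℤ.* + (1 * suc d) ≡ + (7 * suc d)
exponent-denominator d = trans (sym (ℤ.pos-* 7 (1 * suc d))) (cong (λ e → + (7 * e)) (*-identityˡ (suc d)))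

toℚᵘ-exponent : ∀ n r d →
  ℚ.toℚᵘ (+ n / 1 ℚ.+ + r / suc d) ℚᵘ.≃ mkℚᵘ (+ n) 0 ℚᵘ.+ mkℚᵘ (+ r) d
toℚᵘ-exponent n r d = ℚᵘ.≃-trans (ℚ.toℚᵘ-homo-+ (+ n / 1) (+ r / suc d))
  (ℚᵘ.+-cong (ℚ.toℚᵘ-fromℚᵘ (mkℚᵘ (+ n) 0)) (ℚ.toℚᵘ-fromℚᵘ (mkℚᵘ (+ r) d)))

exponent-≥⇒ : ∀ n r d → + 7 / 3 ℚ.≤ + n / 1 ℚ.+ + r / suc d → 7 * suc d ≤ 3 * (n * suc d + r)
exponent-≥⇒ n r d 7/3≤ = ℤ.drop‿+≤+ (subst₂ ℤ._≤_ (exponent-denominator d) (exponent-numerator n r d)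
  (ℚᵘ.drop-*≤* (ℚᵘ.≤-respʳ-≃ (toℚᵘ-exponent n r d) (ℚ.toℚᵘ-mono-≤ 7/3≤))))

exponent-≥⇐ : ∀ n r d → 7 * suc d ≤ 3 * (n * suc d + r) → + 7 / 3 ℚ.≤ + n / 1 ℚ.+ + r / suc d
exponent-≥⇐ n r d 7d≤ = ℚ.toℚᵘ-cancel-≤ (ℚᵘ.≤-respʳ-≃ (ℚᵘ.≃-sym (toℚᵘ-exponent n r d))
  (ℚᵘ.*≤* (subst₂ ℤ._≤_ (sym (exponent-denominator d)) (sym (exponent-numerator n r d)) (ℤ.+≤+ 7d≤))))

-- Words as initial segments of sequences.

applyUpTo-++ : ∀ (f : Sequence) m n →
  applyUpTo f (m + n) ≡ applyUpTo f m ++ applyUpTo (shift m f) n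
applyUpTo-++ f zero n = refl
applyUpTo-++ f (suc m) n = cong (f 0 ∷_) (applyUpTo-++ (f ∘ suc) m n)

applyUpTo-cong : ∀ {f g : Sequence} n → (∀ i → i < n → f i ≡ g i) → applyUpTo f n ≡ applyUpTo g n
applyUpTo-cong zero f≈g = refl
applyUpTo-cong (suc n) f≈g =
  cong₂ _∷_ (f≈g 0 z<s) (applyUpTo-cong n (λ i i<n → f≈g (suc i) (s<s i<n)))

applyUpTo-injective : ∀ {f g : Sequence} n → applyUpTo f n ≡ applyUpTo g n → ∀ i → i < n → f i ≡ g i
applyUpTo-injective (suc n) eq zero _ = proj₁ (∷-injective eq)
applyUpTo-injective (suc n) eq (suc i) (s≤s i<n) =
  applyUpTo-injective n (proj₂ (∷-injective eq)) i i<n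

++≡applyUpTo : ∀ u {v} {f : Sequence} n → u ++ v ≡ applyUpTo f n →
  u ≡ applyUpTo f (length u) × v ≡ applyUpTo (shift (length u) f) (length v) × length u + length v ≡ n
++≡applyUpTo [] {v} {f} n eq = refl , trans eq (cong (applyUpTo f) (sym |v|≡n)) , |v|≡n
  where
  |v|≡n : length v ≡ n
  |v|≡n = trans (cong length eq) (length-applyUpTo f n)
++≡applyUpTo (b ∷ u) {f = f} (suc n) eq =
  let b≡ , eq′ = ∷-injective eq
      u≡ , v≡ , n≡ = ++≡applyUpTo u n eq′
  in cong₂ _∷_ b≡ u≡ , v≡ , cong suc n≡

Prefix⇒++ : ∀ {u w : Word} → Prefix _≡_ u w → ∃[ v ] w ≡ u ++ v
Prefix⇒++ pre with pw Prefix.++ v ← Prefix.toView pre =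
  v , cong (_++ v) (sym (Pointwise.Pointwise-≡⇒≡ pw))

++⇒Prefix : ∀ {w : Word} u v → w ≡ u ++ v → Prefix _≡_ u w
++⇒Prefix u v refl = Prefix.fromView (Pointwise.refl refl Prefix.++ v)

Infix⇒++ : ∀ {v w : Word} → Infix _≡_ v w → ∃[ l ] ∃[ r ] w ≡ l ++ v ++ r
Infix⇒++ inf with Infix.MkView l pw r ← Infix.toView inf =
  l , r , cong (λ v → l ++ v ++ r) (sym (Pointwise.Pointwise-≡⇒≡ pw))

++⇒Infix : ∀ {w : Word} l v r → w ≡ l ++ v ++ r → Infix _≡_ v w
++⇒Infix l v r refl = Infix.fromView (Infix.MkView l (Pointwise.refl refl) r)

-- Powers of words and powers of sequences.

-- The power is cut down to exponent 2 + r/p with r ≤ p, which fixes the integer part at 2. Both n -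
-- p and p are at least p/3, so their minimum `r` still gives exponent at least 7/3.
HighPower⇒IsPower : ∀ {g : Sequence} {p n} → HighPower g p n →
  ∃[ r ] p + r ≤ n × ∃[ β ] + 7 / 3 ℚ.≤ β × IsPower β (applyUpTo g (p + (p + r)))
HighPower⇒IsPower {g} {suc q} {n} power = r , p+r≤n , _ ,
  exponent-≥⇐ 2 (length x′) (length tail)
    (subst₂ (λ a b → 7 * suc a ≤ 3 * (2 * suc a + b))
      (sym (length-applyUpTo (g ∘ suc) q)) (sym (length-applyUpTo g r)) 7p≤) ,
  (g 0 ∷ tail) , 2 , x′ ,
  ++⇒Prefix x′ _ (trans (cong (applyUpTo g) (sym (m+[n∸m]≡n r≤p))) (applyUpTo-++ g r (p ∸ r))) ,
  word≡ , refl
  where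
  open HighPower power
  p = suc q
  r = (n ∸ p) ⊓ p
  x = applyUpTo g p
  x′ = applyUpTo g r
  tail = applyUpTo (g ∘ suc) q
  r≤p : r ≤ p
  r≤p = m⊓n≤n (n ∸ p) p
  p+r≤n : p + r ≤ n
  p+r≤n = subst (p + r ≤_) (m+[n∸m]≡n (<⇒≤ p<n)) (+-monoʳ-≤ p (m⊓n≤m (n ∸ p) p))
  p≤3r : p ≤ 3 * r
  p≤3r = subst (p ≤_) (sym (*-distribˡ-⊓ 3 (n ∸ p) p))
    (⊓-glb (subst (p ≤_) (sym (*-distribˡ-∸ 3 n p)) (m+n≤o⇒m≤o∸n p excess)) (m≤m+n p _))
  7p≤ : 7 * p ≤ 3 * (2 * p + r)
  7p≤ = subst₂ _≤_ (eq₁ p) (eq₂ p r) (+-monoʳ-≤ (6 * p) p≤3r)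
    where
    eq₁ : ∀ p → 6 * p + p ≡ 7 * p
    eq₁ = solve-∀
    eq₂ : ∀ p r → 6 * p + 3 * r ≡ 3 * (2 * p + r)
    eq₂ = solve-∀
  peel : ∀ k → k ≤ n → applyUpTo g (p + k) ≡ x ++ applyUpTo g k
  peel k k≤n = trans (applyUpTo-++ g p k)
    (cong (x ++_) (applyUpTo-cong k (λ i i<k → sym (repeats i (<-≤-trans i<k k≤n)))))
  word≡ : applyUpTo g (p + (p + r)) ≡ x ^ʷ 2 ++ x′
  word≡ = begin
    applyUpTo g (p + (p + r))   ≡⟨ peel (p + r) p+r≤n ⟩
    x ++ applyUpTo g (p + r)    ≡⟨ cong (x ++_) (peel r (≤-trans (m≤n+m r p) p+r≤n)) ⟩
    x ++ x ++ x′                ≡⟨ ++-assoc x x x′ ⟨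
    (x ++ x) ++ x′              ≡⟨ cong (λ y → (x ++ y) ++ x′) (++-identityʳ x) ⟨
    (x ++ x ++ []) ++ x′        ∎
    where open ≡-Reasoning

PowerFree⇒FreeBelow : ∀ f N → PowerFree (+ 7 / 3) (applyUpTo f N) → FreeBelow N f
PowerFree⇒FreeBelow f N free s {p} {n} s+p+n<N power
  with r , p+r≤n , β , 7/3≤β , isPower ← HighPower⇒IsPower power =
  free (++⇒Infix (applyUpTo f s) (applyUpTo g ℓ) _
    (begin
      applyUpTo f N                    ≡⟨ cong (applyUpTo f) (m+[n∸m]≡n s+ℓ≤N) ⟨
      applyUpTo f (s + ℓ + k)          ≡⟨ cong (applyUpTo f) (+-assoc s ℓ k) ⟩
      applyUpTo f (s + (ℓ + k))        ≡⟨ applyUpTo-++ f s (ℓ + k) ⟩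
      applyUpTo f s ++ applyUpTo g (ℓ + k)
        ≡⟨ cong (applyUpTo f s ++_) (applyUpTo-++ g ℓ k) ⟩
      applyUpTo f s ++ applyUpTo g ℓ ++ applyUpTo (shift ℓ g) k ∎))
    7/3≤β isPower
  where
  open ≡-Reasoning
  g = shift s f
  ℓ = p + (p + r)
  k = N ∸ (s + ℓ)
  s+ℓ≤N : s + ℓ ≤ N
  s+ℓ≤N = ≤-trans (+-monoʳ-≤ s (+-monoʳ-≤ p p+r≤n)) (<⇒≤ s+p+n<N)

^ʷ-comm : ∀ x k → x ++ x ^ʷ k ≡ x ^ʷ k ++ x
^ʷ-comm x zero = ++-identityʳ x
^ʷ-comm x (suc k) = trans (cong (x ++_) (^ʷ-comm x k)) (sym (++-assoc x (x ^ʷ k) x))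

length-^ʷ : ∀ x k → length (x ^ʷ k) ≡ k * length x
length-^ʷ x zero = refl
length-^ʷ x (suc k) = trans (length-++ x) (cong (λ l → length x + l) (length-^ʷ x k))

-- Write the power as x y with y = x^k x′. Since x = x′ z, it is also y z x′; so y occurs both at
-- the start and at distance |x|, which is the repetition.
IsPower⇒HighPower : ∀ {β} {g : Sequence} {ℓ} → + 7 / 3 ℚ.≤ β → IsPower β (applyUpTo g ℓ) →
  ∃[ p ] ∃[ n ] p + n ≡ ℓ × HighPower g p n
IsPower⇒HighPower {g = g} {ℓ} 7/3≤β (x⁺@(b ∷ bs) , k , x′ , pre , w≡ , refl) =
  power k w≡ (exponent-≥⇒ k (length x′) (length bs) 7/3≤β)
  where
  x = List⁺.toList x⁺
  p = length x
  z = proj₁ (Prefix⇒++ pre)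
  x≡ : x ≡ x′ ++ z
  x≡ = proj₂ (Prefix⇒++ pre)
  x′≤x : length x′ ≤ p
  x′≤x = subst (length x′ ≤_) (sym (trans (cong length x≡) (length-++ x′))) (m≤m+n _ _)
  power : ∀ k → applyUpTo g ℓ ≡ x ^ʷ k ++ x′ → 7 * p ≤ 3 * (k * p + length x′) →
    ∃[ p ] ∃[ n ] p + n ≡ ℓ × HighPower g p n
  -- Integer part 0 leaves the exponent |x′|/|x| ≤ 1.
  power zero _ 7p≤ = contradiction (≤-trans 7p≤ (*-monoʳ-≤ 3 x′≤x)) (<⇒≱ (*-monoˡ-< p (m≤m+n 4 3)))
  power (suc k) w≡ 7p≤ = p , length y , ℓ≡ ,
    highPower z<s
      (+-cancelˡ-≤ (3 * p) _ _ (subst₂ _≤_ (eq₁ p) (eq₂ p (length y))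
        (subst (λ l → 7 * p ≤ 3 * l) |w|≡ 7p≤)))
      (applyUpTo-injective (length y) (trans (sym y≡₁) y≡₂))
    where
    y = x ^ʷ k ++ x′
    x++y≡ : x ++ y ≡ applyUpTo g ℓ
    x++y≡ = trans (sym (++-assoc x (x ^ʷ k) x′)) (sym w≡)
    y++≡ : y ++ z ++ x′ ≡ applyUpTo g ℓ
    y++≡ = begin
      (x ^ʷ k ++ x′) ++ z ++ x′   ≡⟨ ++-assoc (x ^ʷ k) x′ (z ++ x′) ⟩
      x ^ʷ k ++ x′ ++ z ++ x′     ≡⟨ cong (x ^ʷ k ++_) (++-assoc x′ z x′) ⟨
      x ^ʷ k ++ (x′ ++ z) ++ x′   ≡⟨ cong (λ u → x ^ʷ k ++ u ++ x′) x≡ ⟨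
      x ^ʷ k ++ x ++ x′           ≡⟨ ++-assoc (x ^ʷ k) x x′ ⟨
      (x ^ʷ k ++ x) ++ x′         ≡⟨ cong (_++ x′) (^ʷ-comm x k) ⟨
      (x ++ x ^ʷ k) ++ x′         ≡⟨ w≡ ⟨
      applyUpTo g ℓ               ∎
      where open ≡-Reasoning
    y≡₁ : y ≡ applyUpTo g (length y)
    y≡₁ = proj₁ (++≡applyUpTo y ℓ y++≡)
    y≡₂ : y ≡ applyUpTo (shift p g) (length y)
    y≡₂ = proj₁ (proj₂ (++≡applyUpTo x ℓ x++y≡))
    ℓ≡ : p + length y ≡ ℓ
    ℓ≡ = proj₂ (proj₂ (++≡applyUpTo x ℓ x++y≡))
    |w|≡ : suc k * p + length x′ ≡ p + length y
    |w|≡ = trans (+-assoc p (k * p) (length x′))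
      (cong (λ l → p + l) (sym (trans (length-++ (x ^ʷ k)) (cong (_+ length x′) (length-^ʷ x k)))))
    eq₁ : ∀ p → 7 * p ≡ 3 * p + 4 * p
    eq₁ = solve-∀
    eq₂ : ∀ p n → 3 * (p + n) ≡ 3 * p + 3 * n
    eq₂ = solve-∀

-- The bound in `FreeBelow` being strict, `suc N` lets a power use the last letter of the word.
FreeBelow⇒PowerFree : ∀ f N → FreeBelow (suc N) f → PowerFree (+ 7 / 3) (applyUpTo f N)
FreeBelow⇒PowerFree f N free {v} inf 7/3≤β isPower
  with l , r , eq ← Infix⇒++ inf
  with _ , v++r≡ , N≡ ← ++≡applyUpTo l {v ++ r} N (sym eq)
  with v≡ , _ , _ ← ++≡applyUpTo v (length (v ++ r)) v++r≡
  with p , n , ℓ≡ , power ← IsPower⇒HighPower 7/3≤β (subst (IsPower _) v≡ isPower) =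
  free (length l) (s≤s (≤-trans (+-monoʳ-≤ (length l) (begin
    p + n           ≡⟨ ℓ≡ ⟩
    length v        ≤⟨ m≤m+n _ _ ⟩
    length v + length r ≡⟨ length-++ v ⟨
    length (v ++ r) ∎)) (≤-reflexive N≡))) power
  where open ≤-Reasoning

-- The words of `𝒜` and their conjugates.

μ-applyUpTo : ∀ t n → μ (applyUpTo t n) ≡ applyUpTo (μ∞ t) (n * 2)
μ-applyUpTo t zero = refl
μ-applyUpTo t (suc n) = cong₂ _++_ (μ₁≡ (t 0)) (μ-applyUpTo (t ∘ suc) n)
  where
  μ₁≡ : ∀ b → μ₁ b ≡ b ∷ flip b ∷ []
  μ₁≡ 0F = refl
  μ₁≡ 1F = refl

Root⇒𝒜 : ∀ {m t} → Root m t → 𝒜 (applyUpTo t (m * 2))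
Root⇒𝒜 (const 0F) = 0 , _ , here refl , refl
Root⇒𝒜 (const 1F) = 0 , _ , there (here refl) , refl
Root⇒𝒜 (aba 0F) = 0 , _ , there (there (here refl)) , refl
Root⇒𝒜 (aba 1F) = 0 , _ , there (there (there (here refl))) , refl
Root⇒𝒜 (image {m} {t} r) with k , a , a∈A , eq ← Root⇒𝒜 r =
  suc k , a , a∈A , trans (sym (μ-applyUpTo t (m * 2))) (cong μ eq)

𝒜⇒Root : ∀ {w} → 𝒜 w → ∃[ m ] ∃[ t ] Root m t × w ≡ applyUpTo t (m * 2)
𝒜⇒Root (zero , _ , here refl , w≡) = _ , _ , const 0F , w≡
𝒜⇒Root (zero , _ , there (here refl) , w≡) = _ , _ , const 1F , w≡
𝒜⇒Root (zero , _ , there (there (here refl)) , w≡) = _ , _ , aba 0F , w≡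
𝒜⇒Root (zero , _ , there (there (there (here refl))) , w≡) = _ , _ , aba 1F , w≡
𝒜⇒Root (suc k , a , a∈A , w≡) with m , t , r , eq ← 𝒜⇒Root (k , a , a∈A , refl) =
  _ , _ , image r , trans w≡ (trans (cong μ eq) (μ-applyUpTo t (m * 2)))

rotate : ∀ {t : Sequence} {N} u v → Periodic t N → u + v ≡ N →
  applyUpTo (shift u t) N ≡ applyUpTo (shift u t) v ++ applyUpTo t u
rotate {t} {N} u v per u+v≡N = begin
  applyUpTo (shift u t) N         ≡⟨ cong (applyUpTo (shift u t)) (trans (+-comm v u) u+v≡N) ⟨
  applyUpTo (shift u t) (v + u)   ≡⟨ applyUpTo-++ (shift u t) v u ⟩
  applyUpTo (shift u t) v ++ applyUpTo (shift v (shift u t)) u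
    ≡⟨ cong (applyUpTo (shift u t) v ++_) (applyUpTo-cong u λ i _ →
        trans (cong t (trans (sym (+-assoc u v i)) (cong (_+ i) u+v≡N))) (per i)) ⟩
  applyUpTo (shift u t) v ++ applyUpTo t u ∎
  where open ≡-Reasoning

shift-Conjugate : ∀ {t : Sequence} N → Periodic t (suc N) → ∀ s →
  Conjugate (applyUpTo t (suc N)) (applyUpTo (shift s t) (suc N))
shift-Conjugate {t} N per s = applyUpTo t u , applyUpTo (shift u t) v ,
  trans (cong (applyUpTo t) (sym u+v≡)) (applyUpTo-++ t u v) ,
  trans (applyUpTo-cong (suc N) (λ i _ → shift-% N per s i)) (rotate u v per u+v≡)
  where
  -- The cut of a conjugate lies inside the word, so the shift is reduced modulo the length.
  u = s % suc N
  v = suc N ∸ u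
  u+v≡ : u + v ≡ suc N
  u+v≡ = m+[n∸m]≡n (<⇒≤ (m%n<n s (suc N)))

Conjugate⇒shift : ∀ {t : Sequence} {N w} → Periodic t N → Conjugate (applyUpTo t N) w →
  ∃[ s ] w ≡ applyUpTo (shift s t) N
Conjugate⇒shift {t} {N} per (u , v , eq , w≡)
  with u≡ , v≡ , N≡ ← ++≡applyUpTo u N (sym eq) =
  length u , trans w≡ (trans (cong₂ _++_ v≡ u≡) (sym (rotate (length u) (length v) per N≡)))

double-periodic : ∀ {t} m → Periodic t m → Periodic t (m * 2)
double-periodic {t} m per = subst (Periodic t) (*-comm 2 m) (*-periodic per 2)

Rooted⇒conjugate : ∀ {f m} → Rooted f m → ConjugatesOf 𝒜 (applyUpTo f (m * 2))
Rooted⇒conjugate {f} {m} (t , root , s , f≗) with Root-positive root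
... | s≤s {n = m′} _ = applyUpTo t (m * 2) , Root⇒𝒜 root ,
  subst (Conjugate _) (applyUpTo-cong (m * 2) (λ i _ → sym (f≗ i)))
    (shift-Conjugate (suc (m′ * 2)) (double-periodic m (Root-periodic root)) s)

applyUpTo-double : ∀ {f : Sequence} m → Periodic f m →
  applyUpTo f (m * 2) ≡ applyUpTo f m ++ applyUpTo f m
applyUpTo-double {f} m per = begin
  applyUpTo f (m * 2)                      ≡⟨ cong (applyUpTo f) (eq m) ⟩
  applyUpTo f (m + m)                      ≡⟨ applyUpTo-++ f m m ⟩
  applyUpTo f m ++ applyUpTo (shift m f) m
    ≡⟨ cong (applyUpTo f m ++_) (applyUpTo-cong m (λ i _ → per i)) ⟩
  applyUpTo f m ++ applyUpTo f m           ∎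
  where
  open ≡-Reasoning
  eq : ∀ m → m * 2 ≡ m + m
  eq = solve-∀

-- Squares as periodic sequences, and the two inclusions.

-- The default `0F` is never read: wherever `at` is used, the indices stay below the length.
at : Word → Sequence
at [] _ = 0F
at (b ∷ w) zero = b
at (b ∷ w) (suc i) = at w i

applyUpTo-at : ∀ w → applyUpTo (at w) (length w) ≡ w
applyUpTo-at [] = refl
applyUpTo-at (b ∷ w) = cong (b ∷_) (applyUpTo-at w)

free-square⇒conjugate : ∀ b bs → let x = b ∷ bs in
  PowerFree (+ 7 / 3) (x ++ x) → ConjugatesOf 𝒜 (x ++ x)
free-square⇒conjugate b bs free = subst (ConjugatesOf 𝒜) xx≡
  (Rooted⇒conjugate (free⇒rooted m z<s (<-wellFounded m) per
    (PowerFree⇒FreeBelow f (m * 2) (subst (PowerFree (+ 7 / 3)) (sym xx≡) free))))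
  where
  x = b ∷ bs
  m = length x
  f : Sequence
  f i = at x (i % m)
  per : Periodic f m
  per i = cong (at x) (trans (cong (_% m) (+-comm m i)) ([m+n]%n≡m%n i m))
  x≡ : applyUpTo f m ≡ x
  x≡ = trans (applyUpTo-cong m (λ i i<m → cong (at x) (m<n⇒m%n≡m i<m))) (applyUpTo-at x)
  xx≡ : applyUpTo f (m * 2) ≡ x ++ x
  xx≡ = trans (applyUpTo-double m per) (cong₂ _++_ x≡ x≡)

Root⇒square : ∀ {m t} → Root m t → ∀ s → Square (applyUpTo (shift s t) (m * 2))
Root⇒square {m} {t} root s with Root-positive root
... | s≤s {n = m′} _ = (shift s t 0 ∷ applyUpTo (shift s t ∘ suc) m′) ,
  applyUpTo-double m (shift-periodic {t} s (Root-periodic root))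

Root⇒PowerFree : ∀ {m t} → Root m t → ∀ s → PowerFree (+ 7 / 3) (applyUpTo (shift s t) (m * 2))
Root⇒PowerFree {m} {t} root s = FreeBelow⇒PowerFree (shift s t) (m * 2) λ s′ s′+p+n≤ power →
  -- The start s + s′ may be anywhere in `t`; only the length of the power is bounded.
  Root-free root (s + s′) (m+n≤o⇒n≤o s′ (≤-pred s′+p+n≤))
    (HighPower-cong (λ i → cong t (sym (+-assoc s s′ i))) power)

theorem2 : (Square ∩ PowerFree (+ 7 / 3)) ≐ ConjugatesOf 𝒜
theorem2 = square⇒conjugate , conjugate⇒square
  where
  square⇒conjugate : ∀ {w} → (Square ∩ PowerFree (+ 7 / 3)) w → ConjugatesOf 𝒜 w
  square⇒conjugate ((b ∷ bs , refl) , free) = free-square⇒conjugate b bs free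

  conjugate⇒square : ∀ {w} → ConjugatesOf 𝒜 w → (Square ∩ PowerFree (+ 7 / 3)) w
  conjugate⇒square (_ , x∈𝒜 , conj)
    with m , t , root , refl ← 𝒜⇒Root x∈𝒜
    with s , refl ← Conjugate⇒shift (double-periodic m (Root-periodic root)) conj =
    Root⇒square root s , Root⇒PowerFree root s
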